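{- Let $S$ be any set of sentence symbols and let $v : S \to \{T,F\}$ be any function (a truth assignment for $S$). Then there exists a unique function $\overline{v} : \overline{S} \to \{T,F\}$ satisfying all of the following conditions: 0. For every sentence symbol $A \in S$, $\overline{v}(A) = v(A)$. And for all $\alpha, \beta \in \overline{S}$: 1. $\overline{v}((\neg \alpha)) = T$ if $\overline{v}(\alpha) = F$, and $\overline{v}((\neg\alpha)) = F$ if $\overline{v}(\alpha) = T$. 2. $\overline{v}((\alpha \wedge \beta)) = T$ if $\overline{v}(\alpha) = \overline{v}(\beta) = T$, and $F$ otherwise. 3. $\overline{v}((\alpha \vee \beta)) = T$ if $\overline{v}(\alpha) = T$ or $\overline{v}(\beta) = T$ (or both), and $F$ otherwise. 4. $\overline{v}((\alpha \rightarrow \beta)) = F$ if $\overline{v}(\alpha) = T$ and $\overline{v}(\beta) = F$, and $T$ otherwise. 5. $\overline{v}((\alpha \leftrightarrow \beta)) = T$ if $\overline{v}(\alpha) = \overline{v}(\beta)$, and $F$ otherwise.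
   Context: The language of sentential logic (LSL) has as symbols the two parentheses $($ and $)$, the connectives $\neg, \wedge, \vee, \rightarrow, \leftrightarrow$, and the sentence symbols $A_1, A_2, A_3, \dots$; all these symbols are distinct. An expression is a finite sequence of symbols; a sentence symbol is identified with the corresponding expression of length one. For arbitrary expressions $\alpha,\beta$ the formula-building operations are defined by concatenation: $\varepsilon_\neg(\alpha) = (\neg\alpha)$ and $\varepsilon_\square(\alpha,\beta) = (\alpha \,\square\, \beta)$ for $\square \in \{\wedge,\vee,\rightarrow,\leftrightarrow\}$. A construction sequence is a finite sequence $\langle \varepsilon_1,\dots,\varepsilon_n\rangle$ ($n \ge 1$) of expressions such that for every $i \le n$, either $\varepsilon_i$ is a sentence symbol, or $\varepsilon_i = \varepsilon_\neg(\varepsilon_j)$ for some $j<i$, or $\varepsilon_i = \varepsilon_\square(\varepsilon_j,\varepsilon_k)$ for some $j,k<i$ and some $\square \in \{\wedge,\vee,\rightarrow,\leftrightarrow\}$. An expression $\alpha$ is a well-formed formula (wff) if there is a construction sequence $\langle \varepsilon_1,\dots,\varepsilon_n\rangle$ with $\varepsilon_n = \alpha$. For a set $S$ of sentence symbols, $\overline{S}$ is the set of all wffs $\alpha$ such that every sentence symbol occurring in $\alpha$ belongs to $S$. The truth values $T$ and $F$ are two distinct objects. -}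

module Defs where

open import Level using (Level)
open import Data.Bool.Base using (Bool; true; false)
open import Data.Nat.Base as ℕ using (ℕ; suc; _+_)
import Data.Nat.Properties as ℕ
open import Data.Fin.Base using (Fin; toℕ; fromℕ; inject₁; _<_; _↑ˡ_; _↑ʳ_; splitAt)
open import Data.Fin.Properties
  using (toℕ-fromℕ; toℕ-inject₁; inject₁ℕ<; toℕ-↑ˡ; toℕ-↑ʳ; join-splitAt)
open import Data.Fin.Relation.Unary.Top using (view; view-fromℕ; view-inject₁; ‵fromℕ; ‵inject₁)
open import Data.List.Base using (List; _∷_; [_]; _++_)
open import Data.List.Membership.Propositional using (_∈_)
open import Data.List.Membership.Propositional.Properties using (∈-++⁻)
open import Data.List.Relation.Unary.Any using (here; there)
open import Data.Product.Base using (Σ; ∃; _×_; _,_; proj₁)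
open import Data.Sum.Base using (_⊎_; inj₁; inj₂)
import Data.Vec.Functional as Vector
open Vector using (Vector)
open import Data.Vec.Functional.Properties using (lookup-++ˡ; lookup-++ʳ)
open import Function.Bundles using (Func; _⟨$⟩_)
open import Relation.Binary.Bundles using (Setoid)
import Relation.Binary.Construct.On as On
open import Relation.Binary.PropositionalEquality
  using (_≡_; refl; sym; trans; cong; cong₂; subst; subst₂; setoid)
open import Relation.Nullary.Negation using (¬_)
open import Relation.Unary using (Pred)

private
  variable
    ℓ : Level
    n : ℕ

-- A n stands for the symbol written A_{n+1}.
data SentenceSymbol : Set where
  A : ℕ → SentenceSymbol

data Connective : Set where
  ∧ ∨ ⇒ ⇔ : Connective

data Symbol : Set where
  ⟨ ⟩ not : Symbol
  conn    : Connective → Symbol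
  atom    : SentenceSymbol → Symbol

Expression : Set
Expression = List Symbol

⌜_⌝ : SentenceSymbol → Expression
⌜ P ⌝ = [ atom P ]

ε¬ : Expression → Expression
ε¬ α = ⟨ ∷ not ∷ α ++ [ ⟩ ]

ε : Connective → Expression → Expression → Expression
ε □ α β = ⟨ ∷ α ++ conn □ ∷ β ++ [ ⟩ ]

data Justified {n} (εs : Vector Expression n) (i : Fin n) : Set where
  symbol   : ∀ P → εs i ≡ ⌜ P ⌝ → Justified εs i
  negation : ∀ j → j < i → εs i ≡ ε¬ (εs j) → Justified εs i
  binary   : ∀ □ j k → j < i → k < i → εs i ≡ ε □ (εs j) (εs k) → Justified εs i

IsConstructionSequence : Vector Expression n → Set
IsConstructionSequence εs = ∀ i → Justified εs i

Wff : Pred Expression _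
Wff α = ∃ λ n → Σ (Vector Expression (suc n)) λ εs →
  IsConstructionSequence εs × εs (fromℕ n) ≡ α

Closure : Pred SentenceSymbol ℓ → Pred Expression ℓ
Closure S α = Wff α × (∀ P → atom P ∈ α → S P)

-- A subset as a setoid: elements carry a membership proof, but are compared
-- only by their underlying object. A Func out of it therefore cannot depend on
-- how membership was proved (e.g. on the choice of construction sequence).
Subset : {X : Set} → Pred X ℓ → Setoid ℓ _
Subset {X = X} P = On.setoid {B = Σ X P} (setoid X) proj₁

-- The truth values T and F are true and false.
TruthFunction : {X : Set} → Pred X ℓ → Set ℓ
TruthFunction P = Func (Subset P) (setoid Bool)

-- Concatenating construction sequences and appending an expression: this gives
-- closure of wffs under the formula-building operations.
private
  justified-map : ∀ {m n} {εs : Vector Expression m} {δs : Vector Expression n}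
    (f : Fin m → Fin n) → (∀ {i j} → i < j → f i < f j) →
    (∀ i → δs (f i) ≡ εs i) → ∀ {i} → Justified εs i → Justified δs (f i)
  justified-map f mono eq {i} (symbol P p) = symbol P (trans (eq i) p)
  justified-map f mono eq {i} (negation j j<i p) =
    negation (f j) (mono j<i) (trans (eq i) (trans p (cong ε¬ (sym (eq j)))))
  justified-map f mono eq {i} (binary □ j k j<i k<i p) =
    binary □ (f j) (f k) (mono j<i) (mono k<i)
      (trans (eq i) (trans p (cong₂ (ε □) (sym (eq j)) (sym (eq k)))))

  snoc : Vector Expression n → Expression → Vector Expression (suc n)
  snoc εs α i with view i
  ... | ‵fromℕ     = α
  ... | ‵inject₁ j = εs j

  snoc-fromℕ : (εs : Vector Expression n) (α : Expression) → snoc εs α (fromℕ n) ≡ α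
  snoc-fromℕ {n} εs α rewrite view-fromℕ n = refl

  snoc-inject₁ : (εs : Vector Expression n) (α : Expression) (i : Fin n) →
    snoc εs α (inject₁ i) ≡ εs i
  snoc-inject₁ εs α i rewrite view-inject₁ i = refl

  inject₁-mono : {i j : Fin n} → i < j → inject₁ i < inject₁ j
  inject₁-mono {i = i} {j} = subst₂ ℕ._<_ (sym (toℕ-inject₁ i)) (sym (toℕ-inject₁ j))

  inject₁<fromℕ : (i : Fin n) → inject₁ i < fromℕ n
  inject₁<fromℕ {n} i = subst (toℕ (inject₁ i) ℕ.<_) (sym (toℕ-fromℕ n)) (inject₁ℕ< i)

  snoc-construction : (εs : Vector Expression n) (α : Expression) →
    IsConstructionSequence εs → Justified (snoc εs α) (fromℕ n) →
    IsConstructionSequence (snoc εs α)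
  snoc-construction εs α c last i with view i
  ... | ‵fromℕ     = last
  ... | ‵inject₁ j = justified-map inject₁ inject₁-mono (snoc-inject₁ εs α) (c j)

  ++-construction : ∀ {m n} (εs : Vector Expression m) (δs : Vector Expression n) →
    IsConstructionSequence εs → IsConstructionSequence δs →
    IsConstructionSequence (εs Vector.++ δs)
  ++-construction {m} {n} εs δs c d i
    with splitAt m i | join-splitAt m n i
  ... | inj₁ j | refl = justified-map (_↑ˡ n)
          (λ {a} {b} → subst₂ ℕ._<_ (sym (toℕ-↑ˡ a n)) (sym (toℕ-↑ˡ b n)))
          (lookup-++ˡ εs δs) (c j)
  ... | inj₂ j | refl = justified-map (m ↑ʳ_)
          (λ {a} {b} a<b → subst₂ ℕ._<_ (sym (toℕ-↑ʳ m a)) (sym (toℕ-↑ʳ m b))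
                             (ℕ.+-monoʳ-< m a<b))
          (lookup-++ʳ εs δs) (d j)

  wff-⌜⌝ : ∀ P → Wff ⌜ P ⌝
  wff-⌜⌝ P = 0 , (λ _ → ⌜ P ⌝) , (λ _ → symbol P refl) , refl

  wff-ε¬ : ∀ {α} → Wff α → Wff (ε¬ α)
  wff-ε¬ {α} (n , εs , c , p) = suc n , snoc εs (ε¬ α) ,
    snoc-construction εs (ε¬ α) c
      (negation (inject₁ (fromℕ n)) (inject₁<fromℕ (fromℕ n))
        (trans (snoc-fromℕ εs (ε¬ α))
          (cong ε¬ (sym (trans (snoc-inject₁ εs _ (fromℕ n)) p))))) ,
    snoc-fromℕ εs (ε¬ α)

  wff-ε : ∀ □ {α β} → Wff α → Wff β → Wff (ε □ α β)
  wff-ε □ {α} {β} (m , εs , c , p) (n , δs , d , q) =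
    suc m + suc n , snoc γs γ ,
    snoc-construction γs γ (++-construction εs δs c d)
      (binary □ (inject₁ i) (inject₁ j) (inject₁<fromℕ i) (inject₁<fromℕ j)
        (trans (snoc-fromℕ γs γ) (cong₂ (ε □)
          (sym (trans (snoc-inject₁ γs γ i) (trans (lookup-++ˡ εs δs (fromℕ m)) p)))
          (sym (trans (snoc-inject₁ γs γ j) (trans (lookup-++ʳ εs δs (fromℕ n)) q)))))) ,
    snoc-fromℕ γs γ
    where
    γs = εs Vector.++ δs
    γ  = ε □ α β
    i  = fromℕ m ↑ˡ suc n
    j  = suc m ↑ʳ fromℕ n

  ∈-ε¬ : ∀ α {P} → atom P ∈ ε¬ α → atom P ∈ α
  ∈-ε¬ α (there (there P∈)) with ∈-++⁻ α P∈
  ... | inj₁ P∈α = P∈α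
  ... | inj₂ (here ())

  ∈-ε : ∀ □ α β {P} → atom P ∈ ε □ α β → atom P ∈ α ⊎ atom P ∈ β
  ∈-ε □ α β (there P∈) with ∈-++⁻ α P∈
  ... | inj₁ P∈α = inj₁ P∈α
  ... | inj₂ (there P∈′) with ∈-++⁻ β P∈′
  ...   | inj₁ P∈β = inj₂ P∈β
  ...   | inj₂ (here ())

module _ {S : Pred SentenceSymbol ℓ} where

  symbolᶜ : Σ SentenceSymbol S → Σ Expression (Closure S)
  symbolᶜ (P , P∈S) = ⌜ P ⌝ , wff-⌜⌝ P , λ { _ (here refl) → P∈S }

  ¬ᶜ_ : Σ Expression (Closure S) → Σ Expression (Closure S)
  ¬ᶜ (α , wα , α⊆S) = ε¬ α , wff-ε¬ wα , λ P P∈ → α⊆S P (∈-ε¬ α P∈)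

  binaryᶜ : Connective → (a b : Σ Expression (Closure S)) → Σ Expression (Closure S)
  binaryᶜ □ (α , wα , α⊆S) (β , wβ , β⊆S) = ε □ α β , wff-ε □ wα wβ , occurs
    where
    occurs : ∀ P → atom P ∈ ε □ α β → S P
    occurs P P∈ with ∈-ε □ α β P∈
    ... | inj₁ P∈α = α⊆S P P∈α
    ... | inj₂ P∈β = β⊆S P P∈β

  record Extends (v : TruthFunction S) (v̄ : TruthFunction (Closure S)) : Set ℓ where
    field
      on-symbols : ∀ s → v̄ ⟨$⟩ symbolᶜ s ≡ v ⟨$⟩ s

      on-¬ : ∀ a →
        (v̄ ⟨$⟩ a ≡ false → v̄ ⟨$⟩ (¬ᶜ a) ≡ true) ×
        (v̄ ⟨$⟩ a ≡ true  → v̄ ⟨$⟩ (¬ᶜ a) ≡ false)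

      on-∧ : ∀ a b → let both = v̄ ⟨$⟩ a ≡ true × v̄ ⟨$⟩ b ≡ true in
        (both   → v̄ ⟨$⟩ binaryᶜ ∧ a b ≡ true) ×
        (¬ both → v̄ ⟨$⟩ binaryᶜ ∧ a b ≡ false)

      on-∨ : ∀ a b → let either = v̄ ⟨$⟩ a ≡ true ⊎ v̄ ⟨$⟩ b ≡ true in
        (either   → v̄ ⟨$⟩ binaryᶜ ∨ a b ≡ true) ×
        (¬ either → v̄ ⟨$⟩ binaryᶜ ∨ a b ≡ false)

      on-⇒ : ∀ a b → let fails = v̄ ⟨$⟩ a ≡ true × v̄ ⟨$⟩ b ≡ false in
        (fails   → v̄ ⟨$⟩ binaryᶜ ⇒ a b ≡ false) ×
        (¬ fails → v̄ ⟨$⟩ binaryᶜ ⇒ a b ≡ true)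

      on-⇔ : ∀ a b → let agree = v̄ ⟨$⟩ a ≡ v̄ ⟨$⟩ b in
        (agree   → v̄ ⟨$⟩ binaryᶜ ⇔ a b ≡ true) ×
        (¬ agree → v̄ ⟨$⟩ binaryᶜ ⇔ a b ≡ false)

-- Extensional equality of functions.
_≈_ : {X : Set} {P : Pred X ℓ} → TruthFunction P → TruthFunction P → Set ℓ
_≈_ {P = P} = E._≈_
  where import Function.Relation.Binary.Setoid.Equality (Subset P) (setoid Bool) as E

{-# OPTIONS --safe #-}

-- Every wff is the flattening of a formula tree, and flattening is injective
-- because no flattened tree is a proper prefix of another (unique readability).
-- The value of a wff can therefore be computed by recursion on its tree, and it
-- does not depend on the construction sequence the tree was read from.

module Submission where

open import Defs
open import Level using (Level)
open import Data.Product using (∃!)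
open import Relation.Unary using (Pred)

open import Data.Bool.Base as Bool using (Bool; true; false; if_then_else_)
open import Data.Bool.Properties using (_≟_)
open import Data.Fin.Base using (fromℕ)
open import Data.Fin.Induction using (<-wellFounded)
open import Data.List.Base using (_∷_; []; [_]; _++_)
open import Data.List.Membership.Propositional using (_∈_)
open import Data.List.Membership.Propositional.Properties using (∈-++⁺ˡ; ∈-++⁺ʳ)
open import Data.List.Properties using (++-assoc; ∷-injective; ∷-injectiveʳ)
open import Data.List.Relation.Unary.Any using (here; there)
open import Data.Nat.Base using (ℕ)
open import Data.Product.Base using (Σ; ∃; _×_; _,_; proj₁; proj₂)
open import Data.Sum.Base using (_⊎_)
open import Data.Vec.Functional using (Vector)
open import Function.Bundles using (Func; _⟨$⟩_)
open import Induction.WellFounded using (Acc; acc)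
open import Relation.Binary.PropositionalEquality
  using (_≡_; refl; sym; trans; cong; cong₂)
open import Relation.Nullary.Decidable using (Dec; yes; no; does; _×-dec_; _⊎-dec_)
open import Relation.Nullary.Negation using (¬_; contradiction)

private
  variable
    ℓ : Level
    n : ℕ

data Formula : Set where
  var : SentenceSymbol → Formula
  neg : Formula → Formula
  bin : Connective → Formula → Formula → Formula

flatten : Formula → Expression
flatten (var P)     = ⌜ P ⌝
flatten (neg φ)     = ε¬ (flatten φ)
flatten (bin □ φ ψ) = ε □ (flatten φ) (flatten ψ)

-- This tells a negation from a binary formula: after the opening parenthesis the former has `not`,
-- the latter the first symbol of a subformula, which is `⟨` or an atom.
flatten≢not∷ : ∀ φ {xs ys} → ¬ (flatten φ ++ xs ≡ not ∷ ys)
flatten≢not∷ (var _)     ()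
flatten≢not∷ (neg _)     ()
flatten≢not∷ (bin _ _ _) ()

ε¬-++ : ∀ α xs → ε¬ α ++ xs ≡ ⟨ ∷ not ∷ α ++ ⟩ ∷ xs
ε¬-++ α xs = cong (λ zs → ⟨ ∷ not ∷ zs) (++-assoc α [ ⟩ ] xs)

ε-++ : ∀ □ α β xs → ε □ α β ++ xs ≡ ⟨ ∷ α ++ conn □ ∷ β ++ ⟩ ∷ xs
ε-++ □ α β xs = cong (⟨ ∷_) (trans
  (++-assoc α (conn □ ∷ β ++ [ ⟩ ]) xs)
  (cong (λ zs → α ++ conn □ ∷ zs) (++-assoc β [ ⟩ ] xs)))

neg≢bin : ∀ φ □ ψ₁ ψ₂ {xs ys} → ¬ (flatten (neg φ) ++ xs ≡ flatten (bin □ ψ₁ ψ₂) ++ ys)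
neg≢bin φ □ ψ₁ ψ₂ {ys = ys} eq = flatten≢not∷ ψ₁
  (sym (∷-injectiveʳ (trans eq (ε-++ □ (flatten ψ₁) (flatten ψ₂) ys))))

-- The arbitrary remainders make the induction go through: a left subformula is followed by text not
-- yet known to agree, so injectivity alone would be too weak a hypothesis.
flatten-prefix-free : ∀ φ ψ {xs ys} → flatten φ ++ xs ≡ flatten ψ ++ ys → φ ≡ ψ × xs ≡ ys
flatten-prefix-free (var P) (var .P) refl = refl , refl
flatten-prefix-free (neg φ) (neg ψ) {xs} {ys} eq
  with refl , rest ← flatten-prefix-free φ ψ (∷-injectiveʳ (∷-injectiveʳ
         (trans (sym (ε¬-++ (flatten φ) xs)) (trans eq (ε¬-++ (flatten ψ) ys)))))
  = refl , ∷-injectiveʳ rest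
flatten-prefix-free (neg φ) (bin □ ψ₁ ψ₂) eq = contradiction eq (neg≢bin φ □ ψ₁ ψ₂)
flatten-prefix-free (bin □ φ₁ φ₂) (neg ψ) eq = contradiction (sym eq) (neg≢bin ψ □ φ₁ φ₂)
flatten-prefix-free (bin □ φ₁ φ₂) (bin ◇ ψ₁ ψ₂) {xs} {ys} eq
  with refl , rest₁ ← flatten-prefix-free φ₁ ψ₁ (∷-injectiveʳ
         (trans (sym (ε-++ □ (flatten φ₁) (flatten φ₂) xs))
           (trans eq (ε-++ ◇ (flatten ψ₁) (flatten ψ₂) ys))))
  -- Once the left subformulas are cancelled, both remainders begin with the main connective, so `□`
  -- and `◇` coincide.
  with refl , rest₂ ← ∷-injective rest₁
  with refl , rest₃ ← flatten-prefix-free φ₂ ψ₂ rest₂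
  = refl , ∷-injectiveʳ rest₃

flatten-injective : ∀ φ ψ → flatten φ ≡ flatten ψ → φ ≡ ψ
flatten-injective φ ψ eq = proj₁ (flatten-prefix-free φ ψ (cong (_++ []) eq))

Parse : Expression → Set
Parse α = ∃ λ φ → flatten φ ≡ α

-- A justification may point to any earlier entries, hence well-founded recursion on the index.
parse-entry : (εs : Vector Expression n) → IsConstructionSequence εs → ∀ i → Parse (εs i)
parse-entry εs c i = go i (<-wellFounded i)
  where
  go : ∀ i → Acc _ i → Parse (εs i)
  go i (acc rs) with c i
  ... | symbol P eq = var P , sym eq
  ... | negation j j<i eq with φ , p ← go j (rs j<i) =
    neg φ , trans (cong ε¬ p) (sym eq)
  ... | binary □ j k j<i k<i eq with φ , p ← go j (rs j<i) | ψ , q ← go k (rs k<i) =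
    bin □ φ ψ , trans (cong₂ (ε □) p q) (sym eq)

parse : ∀ {α} → Wff α → Parse α
parse (n , εs , c , refl) = parse-entry εs c (fromℕ n)

-- Defined by recursion on the tree so that evidence for a compound splits at once into evidence for
-- its parts.
Over : Pred SentenceSymbol ℓ → Pred Formula ℓ
Over S (var P)     = S P
Over S (neg φ)     = Over S φ
Over S (bin _ φ ψ) = Over S φ × Over S ψ

over : {S : Pred SentenceSymbol ℓ} (φ : Formula) →
  (∀ P → atom P ∈ flatten φ → S P) → Over S φ
over (var P)     occ = occ P (here refl)
over (neg φ)     occ = over φ λ P P∈ → occ P (there (there (∈-++⁺ˡ P∈)))
over (bin □ φ ψ) occ =
  over φ (λ P P∈ → occ P (there (∈-++⁺ˡ P∈))) ,
  over ψ (λ P P∈ → occ P (there (∈-++⁺ʳ (flatten φ) (there (∈-++⁺ˡ P∈)))))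

-- Clauses 2–5 share one shape: the value is verdict □ if Condition □ x y holds,
-- and the opposite value otherwise.
Condition : Connective → Bool → Bool → Set
Condition ∧ x y = x ≡ true × y ≡ true
Condition ∨ x y = x ≡ true ⊎ y ≡ true
Condition ⇒ x y = x ≡ true × y ≡ false
Condition ⇔ x y = x ≡ y

condition? : ∀ □ x y → Dec (Condition □ x y)
condition? ∧ x y = (x ≟ true) ×-dec (y ≟ true)
condition? ∨ x y = (x ≟ true) ⊎-dec (y ≟ true)
condition? ⇒ x y = (x ≟ true) ×-dec (y ≟ false)
condition? ⇔ x y = x ≟ y

verdict : Connective → Bool
verdict ∧ = true
verdict ∨ = true
verdict ⇒ = false
verdict ⇔ = true

⟦_⟧ : Connective → Bool → Bool → Bool
⟦ □ ⟧ x y = if does (condition? □ x y) then verdict □ else Bool.not (verdict □)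

Clause : Connective → Bool → Bool → Bool → Set
Clause □ x y z =
  (Condition □ x y   → z ≡ verdict □) ×
  (¬ Condition □ x y → z ≡ Bool.not (verdict □))

⟦⟧-clause : ∀ □ x y → Clause □ x y (⟦ □ ⟧ x y)
⟦⟧-clause □ x y with condition? □ x y
... | yes holds = (λ _ → refl) , (λ fails → contradiction holds fails)
... | no fails  = (λ holds → contradiction holds fails) , (λ _ → refl)

-- The condition is decidable, so one of the two halves of the clause always applies and fixes the
-- value. Uniqueness rests on this.
clause⇒⟦⟧ : ∀ □ x y {z} → Clause □ x y z → z ≡ ⟦ □ ⟧ x y
clause⇒⟦⟧ □ x y (if-holds , if-fails) with condition? □ x y
... | yes holds = if-holds holds
... | no fails  = if-fails fails

module _ {S : Pred SentenceSymbol ℓ} where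

  -- The clauses of `Extends` mention only wffs built by `symbolᶜ`, `¬ᶜ_` and `binaryᶜ`, so a tree
  -- is rebuilt with exactly these operations.
  compose : ∀ φ → Over S φ → Σ Expression (Closure S)
  compose (var P)     o         = symbolᶜ (P , o)
  compose (neg φ)     o         = ¬ᶜ compose φ o
  compose (bin □ φ ψ) (o₁ , o₂) = binaryᶜ □ (compose φ o₁) (compose ψ o₂)

  compose-flatten : ∀ φ (o : Over S φ) → proj₁ (compose φ o) ≡ flatten φ
  compose-flatten (var P)     o         = refl
  compose-flatten (neg φ)     o         = cong ε¬ (compose-flatten φ o)
  compose-flatten (bin □ φ ψ) (o₁ , o₂) =
    cong₂ (ε □) (compose-flatten φ o₁) (compose-flatten ψ o₂)

  parseᶜ : (a : Σ Expression (Closure S)) → ∃ λ φ → Over S φ × flatten φ ≡ proj₁ a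
  parseᶜ (α , wα , α⊆S) with φ , refl ← parse wα = φ , over φ α⊆S , refl

module _ {S : Pred SentenceSymbol ℓ} (v : TruthFunction S) where

  eval : ∀ φ → Over S φ → Bool
  eval (var P)     o         = v ⟨$⟩ (P , o)
  eval (neg φ)     o         = Bool.not (eval φ o)
  eval (bin □ φ ψ) (o₁ , o₂) = ⟦ □ ⟧ (eval φ o₁) (eval ψ o₂)

  -- Membership in `S` may have several proofs, but `v` respects the equality of `Subset S`, which
  -- compares symbols only.
  eval-irrelevant : ∀ φ (o o′ : Over S φ) → eval φ o ≡ eval φ o′
  eval-irrelevant (var P)     o         o′          = Func.cong v {P , o} {P , o′} refl
  eval-irrelevant (neg φ)     o         o′          = cong Bool.not (eval-irrelevant φ o o′)
  eval-irrelevant (bin □ φ ψ) (o₁ , o₂) (o₁′ , o₂′) =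
    cong₂ ⟦ □ ⟧ (eval-irrelevant φ o₁ o₁′) (eval-irrelevant ψ o₂ o₂′)

  value : Σ Expression (Closure S) → Bool
  value a = let φ , o , _ = parseᶜ a in eval φ o

  -- Unique readability at work: injectivity of `flatten` identifies the parsed tree with `φ`, so
  -- any convenient tree may be used to compute `value`.
  value-eval : ∀ a φ (o : Over S φ) → flatten φ ≡ proj₁ a → value a ≡ eval φ o
  value-eval a φ o eq with ψ , o′ , eq′ ← parseᶜ a
    with refl ← flatten-injective ψ φ (trans eq′ (sym eq)) = eval-irrelevant φ o′ o

  extension : TruthFunction (Closure S)
  extension = record
    { to   = value
    -- The two wff proofs may carry different construction sequences; the tree read from `b` also
    -- flattens to the expression of `a`.
    ; cong = λ {a} {b} α≡β → let φ , o , eq = parseᶜ b in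
        value-eval a φ o (trans eq (sym α≡β))
    }

  value-¬ : ∀ a → value (¬ᶜ a) ≡ Bool.not (value a)
  value-¬ a = let φ , o , eq = parseᶜ a in value-eval (¬ᶜ a) (neg φ) o (cong ε¬ eq)

  value-binary : ∀ □ a b → value (binaryᶜ □ a b) ≡ ⟦ □ ⟧ (value a) (value b)
  value-binary □ a b = let φ , o , eq = parseᶜ a ; ψ , o′ , eq′ = parseᶜ b in
    value-eval (binaryᶜ □ a b) (bin □ φ ψ) (o , o′) (cong₂ (ε □) eq eq′)

  value-clause : ∀ □ a b → Clause □ (value a) (value b) (value (binaryᶜ □ a b))
  value-clause □ a b rewrite value-binary □ a b = ⟦⟧-clause □ (value a) (value b)

  extension-extends : Extends v extension
  extension-extends = record
    { on-symbols = λ (P , P∈S) → value-eval (symbolᶜ (P , P∈S)) (var P) P∈S refl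
    ; on-¬ = λ a →
        (λ a≡F → trans (value-¬ a) (cong Bool.not a≡F)) ,
        (λ a≡T → trans (value-¬ a) (cong Bool.not a≡T))
    ; on-∧ = value-clause ∧
    ; on-∨ = value-clause ∨
    ; on-⇒ = value-clause ⇒
    ; on-⇔ = value-clause ⇔
    }

  module _ {u : TruthFunction (Closure S)} (u-extends : Extends v u) where
    open Extends u-extends

    extends-¬ : ∀ a → u ⟨$⟩ (¬ᶜ a) ≡ Bool.not (u ⟨$⟩ a)
    extends-¬ a with u ⟨$⟩ a | on-¬ a
    ... | true  | _    , if-T = if-T refl
    ... | false | if-F , _    = if-F refl

    extends-clause : ∀ □ a b → Clause □ (u ⟨$⟩ a) (u ⟨$⟩ b) (u ⟨$⟩ binaryᶜ □ a b)
    extends-clause ∧ = on-∧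
    extends-clause ∨ = on-∨
    extends-clause ⇒ = on-⇒
    extends-clause ⇔ = on-⇔

    -- By induction on the tree, the clauses force the value of every extension on rebuilt wffs.
    extends-eval : ∀ φ (o : Over S φ) → u ⟨$⟩ compose φ o ≡ eval φ o
    extends-eval (var P)     o         = on-symbols (P , o)
    extends-eval (neg φ)     o         =
      trans (extends-¬ (compose φ o)) (cong Bool.not (extends-eval φ o))
    extends-eval (bin □ φ ψ) (o₁ , o₂) =
      trans (clause⇒⟦⟧ □ _ _ (extends-clause □ (compose φ o₁) (compose ψ o₂)))
        (cong₂ ⟦ □ ⟧ (extends-eval φ o₁) (extends-eval ψ o₂))

    extension-unique : ∀ a → value a ≡ u ⟨$⟩ a
    extension-unique a = let φ , o , eq = parseᶜ a in
      trans (sym (extends-eval φ o))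
        -- The rebuilt wff and `a` share their expression though not their wff proof, and `u` cannot
        -- tell them apart.
        (Func.cong u {compose φ o} {a} (trans (compose-flatten φ o) eq))

mainTheorem1 : ∀ {ℓ : Level} (S : Pred SentenceSymbol ℓ) (v : TruthFunction S) →
    ∃! _≈_ (λ (v̄ : TruthFunction (Closure S)) → Extends v v̄)
mainTheorem1 S v = extension v , extension-extends v ,
  λ {u} u-extends a → extension-unique v {u} u-extends a
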